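{- Let $\mathbb T=(T,\eta,\mu)$ be a monad on the category of sets, let $(X,e)$ be any $T$-coalgebra, and let $e^\dagger : X\to TY$ be a Kleisli-coinductive solution of $e$. Then for every $\mathbb T$-algebra $(Y,f)$ with carrier $Y$, the map $f\circ e^\dagger : X\to Y$ is a $T$-ca-homomorphism from $(X,e)$ to $(Y,f)$.
   Context: For an endofunctor $T$ on sets, a $T$-coalgebra is a pair $(X,e)$ with $e:X\to TX$, and a $T$-algebra is a pair $(Y,f)$ with $f:TY\to Y$. A $T$-ca-homomorphism (coalgebra--algebra homomorphism) from a $T$-coalgebra $(X,e)$ to a $T$-algebra $(Y,f)$ is a map $h:X\to Y$ with $h=f\circ Th\circ e$. A $\mathbb T$-algebra (Eilenberg--Moore algebra) for a monad $\mathbb T=(T,\eta,\mu)$ is a $T$-algebra $(Y,f)$ with $f\circ\eta_Y=\mathrm{id}_Y$ and $f\circ\mu_Y=f\circ Tf$. For $g:X\to TY$ the Kleisli extension is $g^\star=\mu_Y\circ Tg:TX\to TY$. A Kleisli-coinductive solution of a $T$-coalgebra $(X,e)$ is a map $e^\dagger:X\to TY$ (for some set $Y$) with $e^\dagger=(e^\dagger)^\star\circ e$, i.e. $e^\dagger$ equals the Kleisli composite of $e$ followed by $e^\dagger$. -}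

module Defs where

open import Effect.Functor using (RawFunctor)
open import Function.Base using (id; _∘_)
open import Level using (Level; suc)
open import Relation.Binary.PropositionalEquality using (_≗_)

private
  variable
    ℓ : Level

-- The category of sets is Set ℓ with functions as maps; two maps are equal
-- when they are pointwise equal (_≗_), since function extensionality is not
-- available.  Hence an endofunctor has to respect _≗_ (map-cong), which is
-- automatic in set theory.

record Endofunctor (ℓ : Level) : Set (suc ℓ) where
  field
    T₀         : Set ℓ → Set ℓ
    rawFunctor : RawFunctor T₀

  map : {A B : Set ℓ} → (A → B) → T₀ A → T₀ B
  map = RawFunctor._<$>_ rawFunctor

  field
    map-cong : {A B : Set ℓ} {g h : A → B} → g ≗ h → map g ≗ map h
    map-id   : {A : Set ℓ} → map (id {A = A}) ≗ id
    map-∘    : {A B C : Set ℓ} (h : B → C) (g : A → B) →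
               map (h ∘ g) ≗ map h ∘ map g

record Monad (ℓ : Level) : Set (suc ℓ) where
  field
    T : Endofunctor ℓ

  open Endofunctor T public

  field
    η         : (A : Set ℓ) → A → T₀ A
    μ         : (A : Set ℓ) → T₀ (T₀ A) → T₀ A
    η-natural : {A B : Set ℓ} (g : A → B) → η B ∘ g ≗ map g ∘ η A
    μ-natural : {A B : Set ℓ} (g : A → B) → μ B ∘ map (map g) ≗ map g ∘ μ A
    unitˡ     : (A : Set ℓ) → μ A ∘ η (T₀ A) ≗ id
    unitʳ     : (A : Set ℓ) → μ A ∘ map (η A) ≗ id
    assoc     : (A : Set ℓ) → μ A ∘ μ (T₀ A) ≗ μ A ∘ map (μ A)

  infix 10 _⋆
  _⋆ : {A B : Set ℓ} → (A → T₀ B) → T₀ A → T₀ B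
  _⋆ {B = B} g = μ B ∘ map g

-- Coalgebras and algebras are given by their structure maps on an explicit
-- carrier, so that the carrier of an algebra can be prescribed.

module _ (T : Endofunctor ℓ) where
  open Endofunctor T

  Coalgebra : Set ℓ → Set ℓ
  Coalgebra X = X → T₀ X

  Algebra : Set ℓ → Set ℓ
  Algebra Y = T₀ Y → Y

  IsCaHomomorphism : {X Y : Set ℓ} → Coalgebra X → Algebra Y → (X → Y) → Set ℓ
  IsCaHomomorphism e f h = h ≗ f ∘ map h ∘ e

module _ (𝕋 : Monad ℓ) where
  open Monad 𝕋

  record IsEilenbergMooreAlgebra {Y : Set ℓ} (f : Algebra T Y) : Set ℓ where
    field
      unit : f ∘ η Y ≗ id
      mult : f ∘ μ Y ≗ f ∘ map f

  IsKleisliCoinductiveSolution : {X Y : Set ℓ} →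
                                 Coalgebra T X → (X → T₀ Y) → Set ℓ
  IsKleisliCoinductiveSolution e e† = e† ≗ e† ⋆ ∘ e

{-# OPTIONS --safe #-}
module Submission where

open import Defs
open import Function.Base using (_∘_)
open import Level using (Level)
open import Relation.Binary.PropositionalEquality
  using (cong; module ≡-Reasoning)

-- Unfolding `e† ⋆`, a Kleisli solution is exactly a ca-homomorphism from `e` to the free algebra
-- `μ Y`. The law `mult` makes `f` an algebra morphism from `μ Y` to `f`, and such morphisms
-- preserve ca-homomorphisms under postcomposition.

theorem2p4 : {ℓ : Level} (𝕋 : Monad ℓ) → let open Monad 𝕋 in
    {X Y : Set ℓ} (e : Coalgebra T X) (e† : X → T₀ Y) →
    IsKleisliCoinductiveSolution 𝕋 e e† →
    (f : Algebra T Y) → IsEilenbergMooreAlgebra 𝕋 f →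
    IsCaHomomorphism T e f (f ∘ e†)
theorem2p4 𝕋 {Y = Y} e e† solution f isEM x = begin
  f (e† x)                  ≡⟨ cong f (solution x) ⟩
  f (μ Y (map e† (e x)))    ≡⟨ mult (map e† (e x)) ⟩
  -- Functoriality, read right to left, fuses the two maps into the candidate `f ∘ e†`.
  f (map f (map e† (e x)))  ≡⟨ cong f (map-∘ f e† (e x)) ⟨
  f (map (f ∘ e†) (e x))    ∎
  where
  open Monad 𝕋
  open IsEilenbergMooreAlgebra isEM
  open ≡-Reasoning
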